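{- Under the a-priori realization: (1) the 2-person non-initialized game $(\mathcal{G}_2,u)$ has no uniform Nash equilibrium in mixed strategies whenever $$u_1(c)>u_1(a_1)>u_1(a_2),\qquad u_2(a_1)>u_2(a_2)>u_2(c);$$ (2) the 3-person non-initialized game $(\mathcal{G}_3,u)$ has no uniform Nash equilibrium in mixed strategies whenever $$u_1(a_2)>u_1(a_1)>u_1(a_3)>u_1(c),\quad u_2(a_3)>u_2(a_2)>u_2(a_1)>u_2(c),\quad u_3(a_1)>u_3(a_3)>u_3(a_2)>u_3(c).$$
   Context: For $n\in\{2,3\}$ the game structure $\mathcal{G}_n$ is as follows: the directed graph has non-terminal positions $v_1,\dots,v_n$, terminal positions $a_1,\dots,a_n$, and arcs $(v_1,v_2),\dots,(v_{n-1},v_n),(v_n,v_1)$ (the cycle) and $(v_i,a_i)$, $i=1,\dots,n$. Player $i\in\{1,\dots,n\}$ controls $v_i$. The outcomes are $a_1,\dots,a_n$ (termination there) and $c$ (infinite play). A payoff is $u:\{1,\dots,n\}\times\{a_1,\dots,a_n,c\}\to\mathbb{R}$, written $u_i(a)$. A mixed strategy of player $i$ is a number $p_i\in[0,1]$: the probability of choosing to follow the cycle from $v_i$; with probability $1-p_i$ the move to $a_i$ is chosen. Under the a-priori realization, before the play begins one move is drawn, independently, in every position according to these probabilities, and the play then follows these fixed moves (the same move is repeated whenever a position is revisited) until it terminates or cycles forever. Thus: For $\mathcal{G}_2$ the distribution on $(a_1,a_2,c)$ is $(1-p_1,\;p_1(1-p_2),\;p_1p_2)$ for initial position $v_1$ and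 $(p_2(1-p_1),\;1-p_2,\;p_1p_2)$ for $v_2$. For $\mathcal{G}_3$ the distribution on $(a_1,a_2,a_3,c)$ is $(1-p_1,\;p_1(1-p_2),\;p_1p_2(1-p_3),\;p_1p_2p_3)$ for $v_1$; $(p_2p_3(1-p_1),\;1-p_2,\;p_2(1-p_3),\;p_1p_2p_3)$ for $v_2$; $(p_3(1-p_1),\;p_3p_1(1-p_2),\;1-p_3,\;p_1p_2p_3)$ for $v_3$. Player $i$'s expected payoff is the corresponding expectation of $u_i$. A tuple $(p_1,\dots,p_n)\in[0,1]^n$ is a uniform Nash equilibrium (UNE) if for each initial position $v_j$, $j=1,\dots,n$, no player can strictly increase his expected payoff by changing only his own $p_i\in[0,1]$. -}

module Defs where

open import Data.Fin.Base using (Fin; toℕ)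
import Data.Fin.Properties as Fin
open import Data.Nat.Base as ℕ using (ℕ; zero; suc; NonZero)
open import Data.Nat.DivMod using (_mod_)
import Data.Nat.Properties as ℕ
open import Data.Product.Base using (∃; _×_; _,_)
open import Data.Rational.Base as ℚ using (ℚ; 0ℚ; 1ℚ; ½)
import Data.Rational.Properties as ℚ
open import Data.Rational.Solver using (module +-*-Solver)
open import Data.Vec.Functional using (Vector; []; _∷_; head; tail; foldr; updateAt)
open import Relation.Binary.Definitions using (DecidableEquality)
open import Relation.Binary.PropositionalEquality
  using (_≡_; refl; sym; trans; cong; cong₂; subst)
open import Relation.Nullary using (¬_; Dec; yes; no)

open ℚ.≤-Reasoning

------------------------------------------------------------------------
-- Real numbers, as Cauchy sequences of rationals.  The operations are
-- pointwise.  Equality of reals is not the propositional equality of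
-- sequences, but x ≤ y together with y ≤ x.

Cauchy : (ℕ → ℚ) → Set
Cauchy x = ∀ ε → 0ℚ ℚ.< ε →
  ∃ λ N → ∀ m n → N ℕ.≤ m → N ℕ.≤ n → ℚ.∣ x m ℚ.- x n ∣ ℚ.< ε

record ℝ : Set where
  constructor mkℝ
  field
    seq    : ℕ → ℚ
    cauchy : Cauchy seq

open ℝ public

private
  halves : ∀ ε → ½ ℚ.* ε ℚ.+ ½ ℚ.* ε ≡ ε
  halves ε = trans (sym (ℚ.*-distribʳ-+ ε ½ ½)) (ℚ.*-identityˡ ε)

  half-pos : ∀ {ε} → 0ℚ ℚ.< ε → 0ℚ ℚ.< ½ ℚ.* ε
  half-pos 0<ε = ℚ.*-monoʳ-<-pos ½ 0<ε

  ∣∣+1-pos : ∀ q → ℚ.Positive (ℚ.∣ q ∣ ℚ.+ 1ℚ)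
  ∣∣+1-pos q = ℚ.nonNeg+pos⇒pos ℚ.∣ q ∣ {{ℚ.∣-∣-nonNeg q}} 1ℚ

  abstract
    cauchy-const : ∀ q → Cauchy (λ _ → q)
    cauchy-const q ε 0<ε =
      0 , λ _ _ _ _ → subst (λ r → ℚ.∣ r ∣ ℚ.< ε) (sym (ℚ.+-inverseʳ q)) 0<ε

    cauchy-+ : ∀ {x y} → Cauchy x → Cauchy y → Cauchy (λ n → x n ℚ.+ y n)
    cauchy-+ {x} {y} cx cy ε 0<ε
      with N₁ , h₁ ← cx (½ ℚ.* ε) (half-pos 0<ε)
         | N₂ , h₂ ← cy (½ ℚ.* ε) (half-pos 0<ε)
      = N₁ ℕ.⊔ N₂ , λ m n m≥ n≥ → begin-strict
        ℚ.∣ (x m ℚ.+ y m) ℚ.- (x n ℚ.+ y n) ∣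
          ≡⟨ cong ℚ.∣_∣ (rearrange (x m) (y m) (x n) (y n)) ⟩
        ℚ.∣ (x m ℚ.- x n) ℚ.+ (y m ℚ.- y n) ∣
          ≤⟨ ℚ.∣p+q∣≤∣p∣+∣q∣ (x m ℚ.- x n) (y m ℚ.- y n) ⟩
        ℚ.∣ x m ℚ.- x n ∣ ℚ.+ ℚ.∣ y m ℚ.- y n ∣
          <⟨ ℚ.+-mono-< (h₁ m n (ℕ.m⊔n≤o⇒m≤o N₁ N₂ m≥) (ℕ.m⊔n≤o⇒m≤o N₁ N₂ n≥))
                        (h₂ m n (ℕ.m⊔n≤o⇒n≤o N₁ N₂ m≥) (ℕ.m⊔n≤o⇒n≤o N₁ N₂ n≥)) ⟩
        ½ ℚ.* ε ℚ.+ ½ ℚ.* ε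
          ≡⟨ halves ε ⟩
        ε ∎
      where
      open +-*-Solver
      rearrange : ∀ a b c d → (a ℚ.+ b) ℚ.- (c ℚ.+ d) ≡ (a ℚ.- c) ℚ.+ (b ℚ.- d)
      rearrange = solve 4 (λ a b c d → (a :+ b) :- (c :+ d) := (a :- c) :+ (b :- d)) refl

    cauchy-neg : ∀ {x} → Cauchy x → Cauchy (λ n → ℚ.- x n)
    cauchy-neg {x} cx ε 0<ε with N , h ← cx ε 0<ε
      = N , λ m n m≥ n≥ → begin-strict
        ℚ.∣ (ℚ.- x m) ℚ.- (ℚ.- x n) ∣  ≡⟨ cong ℚ.∣_∣ (sym (ℚ.neg-distrib-+ (x m) (ℚ.- x n))) ⟩
        ℚ.∣ ℚ.- (x m ℚ.- x n) ∣        ≡⟨ ℚ.∣-p∣≡∣p∣ (x m ℚ.- x n) ⟩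
        ℚ.∣ x m ℚ.- x n ∣              <⟨ h m n m≥ n≥ ⟩
        ε                              ∎

  eventually-bounded : ∀ {x} → Cauchy x →
    ∃ λ b → ℚ.Positive b × ∃ λ N → ∀ n → N ℕ.≤ n → ℚ.∣ x n ∣ ℚ.≤ b
  eventually-bounded {x} cx with N , h ← cx 1ℚ (ℚ.positive⁻¹ 1ℚ)
    = ℚ.∣ x N ∣ ℚ.+ 1ℚ , ∣∣+1-pos (x N) , N , λ n n≥ → begin
      ℚ.∣ x n ∣                        ≡⟨ cong ℚ.∣_∣ (shift (x n) (x N)) ⟩
      ℚ.∣ x N ℚ.+ (x n ℚ.- x N) ∣      ≤⟨ ℚ.∣p+q∣≤∣p∣+∣q∣ (x N) (x n ℚ.- x N) ⟩
      ℚ.∣ x N ∣ ℚ.+ ℚ.∣ x n ℚ.- x N ∣  ≤⟨ ℚ.+-monoʳ-≤ ℚ.∣ x N ∣ (ℚ.<⇒≤ (h n N n≥ ℕ.≤-refl)) ⟩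
      ℚ.∣ x N ∣ ℚ.+ 1ℚ                 ∎
    where
    open +-*-Solver
    shift : ∀ a b → a ≡ b ℚ.+ (a ℚ.- b)
    shift = solve 2 (λ a b → a := b :+ (a :- b)) refl

  shrink : ∀ b → ℚ.Positive b → ∀ ε → 0ℚ ℚ.< ε →
    ∃ λ δ → 0ℚ ℚ.< δ × (∀ p q → p ℚ.≤ b → 0ℚ ℚ.≤ q → q ℚ.< δ → p ℚ.* q ℚ.< ε)
  shrink b b>0 ε 0<ε = δ , 0<δ , λ p q p≤b 0≤q q<δ → begin-strict
    p ℚ.* q                 ≤⟨ ℚ.*-monoʳ-≤-nonNeg q {{ℚ.nonNegative 0≤q}} p≤b ⟩
    b ℚ.* q                 <⟨ ℚ.*-monoʳ-<-pos b q<δ ⟩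
    b ℚ.* (ℚ.1/ b ℚ.* ε)    ≡⟨ sym (ℚ.*-assoc b (ℚ.1/ b) ε) ⟩
    (b ℚ.* ℚ.1/ b) ℚ.* ε    ≡⟨ cong (ℚ._* ε) (ℚ.*-inverseʳ b) ⟩
    1ℚ ℚ.* ε                ≡⟨ ℚ.*-identityˡ ε ⟩
    ε                       ∎
    where
    instance
      _ = b>0
      _ = ℚ.pos⇒nonZero b
    δ = ℚ.1/ b ℚ.* ε
    0<δ : 0ℚ ℚ.< δ
    0<δ = subst (ℚ._< δ) (ℚ.*-zeroʳ (ℚ.1/ b))
            (ℚ.*-monoʳ-<-pos (ℚ.1/ b) {{ℚ.1/pos⇒pos b}} 0<ε)

  product-difference : ∀ s t s′ t′ →
    ℚ.∣ s ℚ.* t ℚ.- s′ ℚ.* t′ ∣ ℚ.≤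
    ℚ.∣ s ∣ ℚ.* ℚ.∣ t ℚ.- t′ ∣ ℚ.+ ℚ.∣ t′ ∣ ℚ.* ℚ.∣ s ℚ.- s′ ∣
  product-difference s t s′ t′ = begin
    ℚ.∣ s ℚ.* t ℚ.- s′ ℚ.* t′ ∣
      ≡⟨ cong ℚ.∣_∣ (rearrange s t s′ t′) ⟩
    ℚ.∣ s ℚ.* (t ℚ.- t′) ℚ.+ t′ ℚ.* (s ℚ.- s′) ∣
      ≤⟨ ℚ.∣p+q∣≤∣p∣+∣q∣ (s ℚ.* (t ℚ.- t′)) (t′ ℚ.* (s ℚ.- s′)) ⟩
    ℚ.∣ s ℚ.* (t ℚ.- t′) ∣ ℚ.+ ℚ.∣ t′ ℚ.* (s ℚ.- s′) ∣
      ≡⟨ cong₂ ℚ._+_ (ℚ.∣p*q∣≡∣p∣*∣q∣ s (t ℚ.- t′)) (ℚ.∣p*q∣≡∣p∣*∣q∣ t′ (s ℚ.- s′)) ⟩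
    ℚ.∣ s ∣ ℚ.* ℚ.∣ t ℚ.- t′ ∣ ℚ.+ ℚ.∣ t′ ∣ ℚ.* ℚ.∣ s ℚ.- s′ ∣ ∎
    where
    open +-*-Solver
    rearrange : ∀ a b c d →
      a ℚ.* b ℚ.- c ℚ.* d ≡ a ℚ.* (b ℚ.- d) ℚ.+ d ℚ.* (a ℚ.- c)
    rearrange = solve 4 (λ a b c d →
      a :* b :- c :* d := a :* (b :- d) :+ d :* (a :- c)) refl

  two-halves : ∀ {p q ε} → p ℚ.< ½ ℚ.* ε → q ℚ.< ½ ℚ.* ε → p ℚ.+ q ℚ.< ε
  two-halves {p} {q} {ε} p< q< = subst (p ℚ.+ q ℚ.<_) (halves ε) (ℚ.+-mono-< p< q<)

  abstract
    cauchy-* : ∀ {x y} → Cauchy x → Cauchy y → Cauchy (λ n → x n ℚ.* y n)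
    cauchy-* {x} {y} cx cy ε 0<ε =
      let a , a>0 , N₁ , x≤a = eventually-bounded cx
          b , b>0 , N₂ , y≤b = eventually-bounded cy
          δ , 0<δ , a*δ = shrink a a>0 (½ ℚ.* ε) (half-pos 0<ε)
          η , 0<η , b*η = shrink b b>0 (½ ℚ.* ε) (half-pos 0<ε)
          N₃ , hy = cy δ 0<δ
          N₄ , hx = cx η 0<η
          M = N₁ ℕ.⊔ N₂
          N = N₃ ℕ.⊔ N₄
      in M ℕ.⊔ N , λ m n m≥ n≥ →
        let m≥M = ℕ.m⊔n≤o⇒m≤o M N m≥
            m≥N = ℕ.m⊔n≤o⇒n≤o M N m≥
            n≥M = ℕ.m⊔n≤o⇒m≤o M N n≥
            n≥N = ℕ.m⊔n≤o⇒n≤o M N n≥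
        in ℚ.≤-<-trans (product-difference (x m) (y m) (x n) (y n)) (two-halves
          (a*δ ℚ.∣ x m ∣ ℚ.∣ y m ℚ.- y n ∣
            (x≤a m (ℕ.m⊔n≤o⇒m≤o N₁ N₂ m≥M)) (ℚ.0≤∣p∣ (y m ℚ.- y n))
            (hy m n (ℕ.m⊔n≤o⇒m≤o N₃ N₄ m≥N) (ℕ.m⊔n≤o⇒m≤o N₃ N₄ n≥N)))
          (b*η ℚ.∣ y n ∣ ℚ.∣ x m ℚ.- x n ∣
            (y≤b n (ℕ.m⊔n≤o⇒n≤o N₁ N₂ n≥M)) (ℚ.0≤∣p∣ (x m ℚ.- x n))
            (hx m n (ℕ.m⊔n≤o⇒n≤o N₃ N₄ m≥N) (ℕ.m⊔n≤o⇒n≤o N₃ N₄ n≥N))))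

infixl 7 _*_
infixl 6 _+_ _-_
infix  8 -_
infix  4 _<_ _≤_ _>_

0ℝ 1ℝ : ℝ
0ℝ = mkℝ (λ _ → 0ℚ) (cauchy-const 0ℚ)
1ℝ = mkℝ (λ _ → 1ℚ) (cauchy-const 1ℚ)

-_ : ℝ → ℝ
- x = mkℝ (λ n → ℚ.- seq x n) (cauchy-neg {seq x} (cauchy x))

_+_ _*_ _-_ : ℝ → ℝ → ℝ
x + y = mkℝ (λ n → seq x n ℚ.+ seq y n) (cauchy-+ {seq x} {seq y} (cauchy x) (cauchy y))
x * y = mkℝ (λ n → seq x n ℚ.* seq y n) (cauchy-* {seq x} {seq y} (cauchy x) (cauchy y))
x - y = x + (- y)

_<_ _>_ _≤_ : ℝ → ℝ → Set
x < y = ∃ λ ε → 0ℚ ℚ.< ε × ∃ λ N → ∀ n → N ℕ.≤ n → seq x n ℚ.+ ε ℚ.≤ seq y n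
x > y = y < x
x ≤ y = ¬ (y < x)

∑ : ∀ {n} → Vector ℝ n → ℝ
∑ = foldr _+_ 0ℝ

------------------------------------------------------------------------
-- The game structure 𝒢ₙ.  Indices start from 0F, so v 0F is v₁, etc.

data Position (n : ℕ) : Set where
  v a : Fin n → Position n

data Outcome (n : ℕ) : Set where
  a : Fin n → Outcome n
  c : Outcome n

_≟_ : ∀ {n} → DecidableEquality (Outcome n)
a i ≟ a j with i Fin.≟ j
... | yes refl = yes refl
... | no i≢j   = no λ where refl → i≢j refl
a _ ≟ c   = no λ ()
c   ≟ a _ = no λ ()
c   ≟ c   = yes refl

-- The two arcs leaving a non-terminal position.
data Move : Set where
  follow exit : Move

next : ∀ {n} .{{_ : NonZero n}} → Fin n → Fin n
next {n} i = suc (toℕ i) mod n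

target : ∀ {n} .{{_ : NonZero n}} → Fin n → Move → Position n
target i follow = v (next i)
target i exit   = a i

module _ {n : ℕ} .{{_ : NonZero n}} (s : Vector Move n) where

  step : Position n → Position n
  step (v i) = target i (s i)
  step (a i) = a i

  play : Position n → ℕ → Position n
  play x zero    = x
  play x (suc k) = step (play x k)

  -- The moves are fixed, so a play that has not terminated after n moves
  -- has revisited one of the n non-terminal positions and never terminates.
  outcome : Fin n → Outcome n
  outcome j with play (v j) n
  ... | v _ = c
  ... | a i = a i

------------------------------------------------------------------------
-- Mixed strategies under the a-priori realization.  Player i controls v i
-- and p i is the probability of following the cycle there.

Payoff : ℕ → Set
Payoff n = Fin n → Outcome n → ℝ

Profile : ℕ → Set
Profile n = Vector ℝ n

InUnitInterval : ℝ → Set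
InUnitInterval q = 0ℝ ≤ q × q ≤ 1ℝ

-- Expectation of f when one move is drawn independently in every position.
expectation : ∀ {n} → Profile n → (Vector Move n → ℝ) → ℝ
expectation {zero}  p f = f []
expectation {suc n} p f =
  head p        * expectation (tail p) (λ s → f (follow ∷ s)) +
  (1ℝ - head p) * expectation (tail p) (λ s → f (exit ∷ s))

indicator : {P : Set} → Dec P → ℝ
indicator (yes _) = 1ℝ
indicator (no  _) = 0ℝ

module _ {n : ℕ} .{{_ : NonZero n}} where

  probability : Profile n → Fin n → Outcome n → ℝ
  probability p j o = expectation p (λ s → indicator (outcome s j ≟ o))

  expectedPayoff : Payoff n → Profile n → (player initial : Fin n) → ℝ
  expectedPayoff u p i j =
    ∑ (λ k → probability p j (a k) * u i (a k)) + probability p j c * u i c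

  record IsUNE (u : Payoff n) (p : Profile n) : Set where
    field
      mixed  : ∀ i → InUnitInterval (p i)
      noGain : ∀ j i q → InUnitInterval q →
        ¬ (expectedPayoff u p i j < expectedPayoff u (updateAt p i (λ _ → q)) i j)

{-# OPTIONS --safe #-}

-- The payoff of a player is affine in that player's own probability, so a
-- deviation to 0 or 1 changes it by (distance moved) × (slope), and the sign of
-- the slope forces the probability to 0 or 1.
--
-- For 𝒢₂: if p₂ > 0, then p₁ = 1 because of the initial position v₂, and then
-- p₂ = 0 because of v₁.  Hence p₂ = 0, which forces p₁ = 0 from v₁, which in
-- turn forces p₂ = 1 from v₂.
--
-- For 𝒢₃: if p₂ and p₃ are positive, then p₁ = 0 because of v₂; so some pᵢ
-- vanishes.  From the own initial position, pᵢ₊₁ = 0 forces pᵢ = 1, while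
-- pᵢ₊₁ = 1 and pᵢ₊₂ = 0 force pᵢ = 0.  Going backwards around the cycle from a
-- vanishing pᵢ yields the values 1, 0 and then pᵢ = 1.

module Submission where

open import Defs
open import Data.Bool.Base using (if_then_else_)
open import Data.Fin.Base using (Fin; suc; _↑ˡ_; _↑ʳ_)
open import Data.Fin.Patterns using (0F; 1F; 2F)
open import Data.Nat.Base as ℕ using (ℕ; zero; suc; nonZero; NonZero)
import Data.Nat.Properties as ℕ
open import Data.Product using (∃; _×_; _,_; proj₁; proj₂)
open import Data.Rational.Base as ℚ using (ℚ; 0ℚ; 1ℚ; ½)
import Data.Rational.Properties as ℚ
open import Data.Rational.Solver using (module +-*-Solver)
open import Data.Sum.Base using (inj₁; inj₂; [_,_]′)
open import Data.Vec.Base as Vec using (Vec)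
open import Data.Vec.Functional using (Vector; []; _∷_; head; tail; foldr; updateAt)
open import Relation.Binary.PropositionalEquality using (_≡_; refl; sym; trans; cong; subst)
open import Relation.Nullary using (¬_)
open import Relation.Nullary.Decidable using (does; from-yes)

open +-*-Solver
open ℚ.≤-Reasoning

infix 4 _≐_ _≃_

-- Order and equality of Cauchy reals

p+q≤r⇒q≤r-p : ∀ p {q r} → p ℚ.+ q ℚ.≤ r → q ℚ.≤ r ℚ.- p
p+q≤r⇒q≤r-p p {q} {r} p+q≤r = begin
  q                ≡⟨ solve 2 (λ p q → q := p :+ q :- p) refl p q ⟩
  p ℚ.+ q ℚ.- p    ≤⟨ ℚ.+-monoˡ-≤ (ℚ.- p) p+q≤r ⟩
  r ℚ.- p          ∎

q≤r-p⇒p+q≤r : ∀ p {q r} → q ℚ.≤ r ℚ.- p → p ℚ.+ q ℚ.≤ r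
q≤r-p⇒p+q≤r p {q} {r} q≤r-p = begin
  p ℚ.+ q          ≤⟨ ℚ.+-monoʳ-≤ p q≤r-p ⟩
  p ℚ.+ (r ℚ.- p)  ≡⟨ solve 2 (λ p r → p :+ (r :- p) := r) refl p r ⟩
  r                ∎

p≤∣p∣ : ∀ p → p ℚ.≤ ℚ.∣ p ∣
p≤∣p∣ p with ℚ.≤-total 0ℚ p
... | inj₁ 0≤p = ℚ.≤-reflexive (sym (ℚ.0≤p⇒∣p∣≡p 0≤p))
... | inj₂ p≤0 = ℚ.≤-trans p≤0 (ℚ.0≤∣p∣ p)

0<½* : ∀ {ε} → 0ℚ ℚ.< ε → 0ℚ ℚ.< ½ ℚ.* ε
0<½* 0<ε = ℚ.*-monoʳ-<-pos ½ 0<ε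

½*≡-½* : ∀ ε → ½ ℚ.* ε ≡ ε ℚ.- ½ ℚ.* ε
½*≡-½* ε = begin-equality
  h                  ≡⟨ solve 1 (λ h → h := h :+ h :- h) refl h ⟩
  h ℚ.+ h ℚ.- h      ≡⟨ cong (ℚ._- h) (sym (ℚ.*-distribʳ-+ ε ½ ½)) ⟩
  1ℚ ℚ.* ε ℚ.- h     ≡⟨ cong (ℚ._- h) (ℚ.*-identityˡ ε) ⟩
  ε ℚ.- h            ∎
  where
  h = ½ ℚ.* ε

-- The operations on reals are pointwise, so ring identities hold term by term; this finer relation
-- is what a ring solver over ℚ can establish.
_≐_ : ℝ → ℝ → Set
x ≐ y = ∀ n → seq x n ≡ seq y n

_≃_ : ℝ → ℝ → Set
x ≃ y = x ≤ y × y ≤ x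

pointwise-≤ : ∀ x y → (∀ n → seq x n ℚ.≤ seq y n) → x ≤ y
pointwise-≤ x y x≤y (ε , 0<ε , N , y+ε≤x) = ℚ.<-irrefl refl (begin-strict
  seq y N          ≡⟨ sym (ℚ.+-identityʳ (seq y N)) ⟩
  seq y N ℚ.+ 0ℚ   <⟨ ℚ.+-monoʳ-< (seq y N) 0<ε ⟩
  seq y N ℚ.+ ε    ≤⟨ y+ε≤x N ℕ.≤-refl ⟩
  seq x N          ≤⟨ x≤y N ⟩
  seq y N          ∎)

x<y⇒0<y-x : ∀ x y → x < y → 0ℝ < y - x
x<y⇒0<y-x x y (ε , 0<ε , N , x+ε≤y) = ε , 0<ε , N , λ n n≥N →
  q≤r-p⇒p+q≤r 0ℚ (subst (ε ℚ.≤_) (sym (ℚ.+-identityʳ _)) (p+q≤r⇒q≤r-p (seq x n) (x+ε≤y n n≥N)))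

0<y-x⇒x<y : ∀ x y → 0ℝ < y - x → x < y
0<y-x⇒x<y x y (ε , 0<ε , N , ε≤y-x) = ε , 0<ε , N , λ n n≥N →
  q≤r-p⇒p+q≤r (seq x n) (subst (ℚ._≤ seq y n ℚ.- seq x n) (ℚ.+-identityˡ ε) (ε≤y-x n n≥N))

<-respʳ-≐ : ∀ x y z → y ≐ z → x < z → x < y
<-respʳ-≐ x y z y≐z (ε , 0<ε , N , x+ε≤z) = ε , 0<ε , N , λ n n≥N →
  subst (seq x n ℚ.+ ε ℚ.≤_) (sym (y≐z n)) (x+ε≤z n n≥N)

<-trans : ∀ x y z → x < y → y < z → x < z
<-trans x y z (ε , 0<ε , M , x+ε≤y) (δ , 0<δ , N , y+δ≤z) = ε , 0<ε , M ℕ.⊔ N , λ n n≥ → begin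
  seq x n ℚ.+ ε    ≤⟨ x+ε≤y n (ℕ.m⊔n≤o⇒m≤o M N n≥) ⟩
  seq y n          ≡⟨ sym (ℚ.+-identityʳ (seq y n)) ⟩
  seq y n ℚ.+ 0ℚ   ≤⟨ ℚ.+-monoʳ-≤ (seq y n) (ℚ.<⇒≤ 0<δ) ⟩
  seq y n ℚ.+ δ    ≤⟨ y+δ≤z n (ℕ.m⊔n≤o⇒n≤o M N n≥) ⟩
  seq z n          ∎

*-pos : ∀ x y → 0ℝ < x → 0ℝ < y → 0ℝ < x * y
*-pos x y (ε , 0<ε , M , ε≤x) (δ , 0<δ , N , δ≤y) =
  ε ℚ.* δ , ℚ.positive⁻¹ (ε ℚ.* δ) {{ℚ.pos*pos⇒pos ε δ}} , M ℕ.⊔ N , λ n n≥ →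
    let ε≤xₙ = subst (ℚ._≤ seq x n) (ℚ.+-identityˡ ε) (ε≤x n (ℕ.m⊔n≤o⇒m≤o M N n≥))
        δ≤yₙ = subst (ℚ._≤ seq y n) (ℚ.+-identityˡ δ) (δ≤y n (ℕ.m⊔n≤o⇒n≤o M N n≥))
        0≤xₙ = ℚ.≤-trans (ℚ.<⇒≤ 0<ε) ε≤xₙ
    in begin
      0ℚ ℚ.+ ε ℚ.* δ      ≡⟨ ℚ.+-identityˡ (ε ℚ.* δ) ⟩
      ε ℚ.* δ             ≤⟨ ℚ.*-monoʳ-≤-nonNeg δ {{ℚ.pos⇒nonNeg δ}} ε≤xₙ ⟩
      seq x n ℚ.* δ       ≤⟨ ℚ.*-monoˡ-≤-nonNeg (seq x n) {{ℚ.nonNegative 0≤xₙ}} δ≤yₙ ⟩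
      seq x n ℚ.* seq y n ∎
  where
  instance
    _ = ℚ.positive 0<ε
    _ = ℚ.positive 0<δ

-- `x ≤ y` is a bare negation, so the index comes from the Cauchy property of `x - y` at `½ε`: a
-- difference of at least `ε` at one late index would stay at least `½ε` at all late ones and
-- witness `y < x`.
≤⇒eventually-close : ∀ x y → x ≤ y → ∀ ε → 0ℚ ℚ.< ε →
  ∃ λ N → ∀ n → N ℕ.≤ n → seq x n ℚ.- seq y n ℚ.< ε
≤⇒eventually-close x y x≤y ε 0<ε with N , close ← cauchy (x - y) (½ ℚ.* ε) (0<½* 0<ε) =
  N , λ n n≥N → ℚ.≰⇒> λ ε≤d → x≤y (½ ℚ.* ε , 0<½* 0<ε , N , λ m m≥N → q≤r-p⇒p+q≤r (seq y m) (begin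
    ½ ℚ.* ε                    ≡⟨ ½*≡-½* ε ⟩
    ε ℚ.- ½ ℚ.* ε              ≤⟨ ℚ.+-mono-≤ ε≤d (ℚ.neg-antimono-≤ (ℚ.<⇒≤ (d-d<½ε n m n≥N m≥N))) ⟩
    d n ℚ.- (d n ℚ.- d m)      ≡⟨ solve 2 (λ s t → s :- (s :- t) := t) refl (d n) (d m) ⟩
    d m                        ∎))
  where
  d : ℕ → ℚ
  d n = seq x n ℚ.- seq y n
  d-d<½ε : ∀ n m → N ℕ.≤ n → N ℕ.≤ m → d n ℚ.- d m ℚ.< ½ ℚ.* ε
  d-d<½ε n m n≥N m≥N = ℚ.≤-<-trans (p≤∣p∣ _) (close n m n≥N m≥N)

∣s-t∣<ε : ∀ s t {ε} → s ℚ.- t ℚ.< ε → t ℚ.- s ℚ.< ε → ℚ.∣ s ℚ.- t ∣ ℚ.< ε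
∣s-t∣<ε s t {ε} s-t<ε t-s<ε = [ (λ eq → subst (ℚ._< ε) (sym eq) s-t<ε)
  , (λ eq → subst (ℚ._< ε) (sym (trans eq (-[s-t]≡t-s s t))) t-s<ε)
  ]′ (ℚ.∣p∣≡p∨∣p∣≡-p (s ℚ.- t))
  where
  -[s-t]≡t-s : ∀ s t → ℚ.- (s ℚ.- t) ≡ t ℚ.- s
  -[s-t]≡t-s = solve 2 (λ s t → :- (s :- t) := t :- s) refl

≃⇒eventually-close : ∀ x y → x ≃ y → ∀ ε → 0ℚ ℚ.< ε →
  ∃ λ N → ∀ n → N ℕ.≤ n → ℚ.∣ seq x n ℚ.- seq y n ∣ ℚ.< ε
≃⇒eventually-close x y (x≤y , y≤x) ε 0<ε =
  let M , x-y<ε = ≤⇒eventually-close x y x≤y ε 0<ε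
      N , y-x<ε = ≤⇒eventually-close y x y≤x ε 0<ε
  in M ℕ.⊔ N , λ n n≥ → ∣s-t∣<ε (seq x n) (seq y n)
       (x-y<ε n (ℕ.m⊔n≤o⇒m≤o M N n≥)) (y-x<ε n (ℕ.m⊔n≤o⇒n≤o M N n≥))

eventually-bounded : ∀ x → ∃ λ b → 0ℚ ℚ.< b × ∃ λ N → ∀ n → N ℕ.≤ n → ℚ.∣ seq x n ∣ ℚ.≤ b
eventually-bounded x with N , close ← cauchy x 1ℚ (ℚ.positive⁻¹ 1ℚ) =
  b , ℚ.positive⁻¹ b {{ℚ.nonNeg+pos⇒pos ℚ.∣ seq x N ∣ {{ℚ.∣-∣-nonNeg (seq x N)}} 1ℚ}} , N , λ n n≥N → begin
    ℚ.∣ seq x n ∣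
      ≡⟨ cong ℚ.∣_∣ (solve 2 (λ s t → s := t :+ (s :- t)) refl (seq x n) (seq x N)) ⟩
    ℚ.∣ seq x N ℚ.+ (seq x n ℚ.- seq x N) ∣
      ≤⟨ ℚ.∣p+q∣≤∣p∣+∣q∣ (seq x N) (seq x n ℚ.- seq x N) ⟩
    ℚ.∣ seq x N ∣ ℚ.+ ℚ.∣ seq x n ℚ.- seq x N ∣
      ≤⟨ ℚ.+-monoʳ-≤ ℚ.∣ seq x N ∣ (ℚ.<⇒≤ (close n N n≥N ℕ.≤-refl)) ⟩
    b ∎
  where
  b = ℚ.∣ seq x N ∣ ℚ.+ 1ℚ

-[d*w]≤δ*b : ∀ d w {δ b} → 0ℚ ℚ.≤ b → ℚ.∣ d ∣ ℚ.≤ δ → ℚ.∣ w ∣ ℚ.≤ b → ℚ.- (d ℚ.* w) ℚ.≤ δ ℚ.* b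
-[d*w]≤δ*b d w {δ} {b} 0≤b ∣d∣≤δ ∣w∣≤b = begin
  ℚ.- (d ℚ.* w)            ≤⟨ p≤∣p∣ (ℚ.- (d ℚ.* w)) ⟩
  ℚ.∣ ℚ.- (d ℚ.* w) ∣      ≡⟨ ℚ.∣-p∣≡∣p∣ (d ℚ.* w) ⟩
  ℚ.∣ d ℚ.* w ∣            ≡⟨ ℚ.∣p*q∣≡∣p∣*∣q∣ d w ⟩
  ℚ.∣ d ∣ ℚ.* ℚ.∣ w ∣      ≤⟨ ℚ.*-monoˡ-≤-nonNeg ℚ.∣ d ∣ {{ℚ.∣-∣-nonNeg d}} ∣w∣≤b ⟩
  ℚ.∣ d ∣ ℚ.* b            ≤⟨ ℚ.*-monoʳ-≤-nonNeg b {{ℚ.nonNegative 0≤b}} ∣d∣≤δ ⟩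
  δ ℚ.* b                  ∎

quotient : ∀ h b → 0ℚ ℚ.< h → 0ℚ ℚ.< b → ∃ λ δ → 0ℚ ℚ.< δ × δ ℚ.* b ≡ h
quotient h b 0<h 0<b = h ℚ.* ℚ.1/ b , ℚ.positive⁻¹ (h ℚ.* ℚ.1/ b) {{ℚ.pos*pos⇒pos h (ℚ.1/ b)}} , (begin-equality
  h ℚ.* ℚ.1/ b ℚ.* b     ≡⟨ ℚ.*-assoc h (ℚ.1/ b) b ⟩
  h ℚ.* (ℚ.1/ b ℚ.* b)   ≡⟨ cong (h ℚ.*_) (ℚ.*-inverseˡ b) ⟩
  h ℚ.* 1ℚ               ≡⟨ ℚ.*-identityʳ h ⟩
  h                      ∎)
  where
  instance
    _ = ℚ.positive 0<h
    _ = ℚ.positive 0<b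
    _ = ℚ.pos⇒nonZero b
    _ = ℚ.1/pos⇒pos b

-- Takes the place of substituting equal reals. As `w` is eventually bounded by some `b`, choosing
-- `δ` with `δ * b` equal to `½ε` keeps the loss below half of the margin `ε` of `z`.
0<-perturb : ∀ z x y w → 0ℝ < z → x ≃ y → 0ℝ < z + (x - y) * w
0<-perturb z x y w (ε , 0<ε , K , ε≤z) x≃y =
  let b , 0<b , M , ∣w∣≤b = eventually-bounded w
      δ , 0<δ , δ*b≡½ε = quotient (½ ℚ.* ε) b (0<½* 0<ε) 0<b
      N , ∣x-y∣<δ = ≃⇒eventually-close x y x≃y δ 0<δ
  in ½ ℚ.* ε , 0<½* 0<ε , K ℕ.⊔ (M ℕ.⊔ N) , λ n n≥ →
    let n≥M⊔N = ℕ.m⊔n≤o⇒n≤o K (M ℕ.⊔ N) n≥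
    in half-remains (seq z n) (seq x n ℚ.- seq y n) (seq w n) (ε≤z n (ℕ.m⊔n≤o⇒m≤o K (M ℕ.⊔ N) n≥))
      (subst (ℚ.- ((seq x n ℚ.- seq y n) ℚ.* seq w n) ℚ.≤_) δ*b≡½ε
        (-[d*w]≤δ*b (seq x n ℚ.- seq y n) (seq w n) (ℚ.<⇒≤ 0<b)
          (ℚ.<⇒≤ (∣x-y∣<δ n (ℕ.m⊔n≤o⇒n≤o M N n≥M⊔N)))
          (∣w∣≤b n (ℕ.m⊔n≤o⇒m≤o M N n≥M⊔N))))
  where
  z--t≡z+t : ∀ z t → z ℚ.- ℚ.- t ≡ z ℚ.+ t
  z--t≡z+t = solve 2 (λ z t → z :- :- t := z :+ t) refl
  half-remains : ∀ z d w → 0ℚ ℚ.+ ε ℚ.≤ z → ℚ.- (d ℚ.* w) ℚ.≤ ½ ℚ.* ε →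
    0ℚ ℚ.+ ½ ℚ.* ε ℚ.≤ z ℚ.+ d ℚ.* w
  half-remains z d w ε≤z -t≤½ε = begin
    0ℚ ℚ.+ ½ ℚ.* ε          ≡⟨ cong (0ℚ ℚ.+_) (½*≡-½* ε) ⟩
    0ℚ ℚ.+ (ε ℚ.- ½ ℚ.* ε)  ≡⟨ sym (ℚ.+-assoc 0ℚ ε (ℚ.- (½ ℚ.* ε))) ⟩
    0ℚ ℚ.+ ε ℚ.- ½ ℚ.* ε    ≤⟨ ℚ.+-mono-≤ ε≤z (ℚ.neg-antimono-≤ -t≤½ε) ⟩
    z ℚ.- ℚ.- (d ℚ.* w)     ≡⟨ z--t≡z+t z (d ℚ.* w) ⟩
    z ℚ.+ d ℚ.* w           ∎

≃0⇒<1 : ∀ x → x ≃ 0ℝ → x < 1ℝ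
-- `1 - x` is read as `1` perturbed by the vanishing difference `x - 0` times `-1`.
≃0⇒<1 x x≃0 = 0<y-x⇒x<y x 1ℝ (<-respʳ-≐ 0ℝ (1ℝ - x) (1ℝ + (x - 0ℝ) * (- 1ℝ))
  (λ n → solve 1 (λ x → con 1ℚ :- x := con 1ℚ :+ (x :- con 0ℚ) :* (:- con 1ℚ)) refl (seq x n))
  (0<-perturb 1ℝ x 0ℝ (- 1ℝ) (1ℚ , ℚ.positive⁻¹ 1ℚ , 0 , λ _ _ → ℚ.≤-refl) x≃0))

-- Deviations from an equilibrium

0∈[0,1] : InUnitInterval 0ℝ
0∈[0,1] = pointwise-≤ 0ℝ 0ℝ (λ _ → ℚ.≤-refl) , pointwise-≤ 0ℝ 1ℝ (λ _ → from-yes (0ℚ ℚ.≤? 1ℚ))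

1∈[0,1] : InUnitInterval 1ℝ
1∈[0,1] = pointwise-≤ 0ℝ 1ℝ (λ _ → from-yes (0ℚ ℚ.≤? 1ℚ)) , pointwise-≤ 1ℝ 1ℝ (λ _ → ℚ.≤-refl)

module _ {n : ℕ} .{{_ : NonZero n}} where

  gain : Payoff n → Profile n → (player initial : Fin n) → ℝ → ℝ
  gain u p i j q = expectedPayoff u (updateAt p i (λ _ → q)) i j - expectedPayoff u p i j

  module _ {u : Payoff n} {p : Profile n} (une : IsUNE u p) where
    open IsUNE une

    gain≯0 : ∀ i j q → InUnitInterval q → ∀ d → gain u p i j q ≐ d → ¬ (0ℝ < d)
    gain≯0 i j q q∈[0,1] d gain≐d 0<d = noGain j i q q∈[0,1]
      (0<y-x⇒x<y (expectedPayoff u p i j) (expectedPayoff u (updateAt p i (λ _ → q)) i j)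
        (<-respʳ-≐ 0ℝ (gain u p i j q) d gain≐d 0<d))

    -- Equality of reals is a pair of negations, so it suffices to refute `p i < 1`, under which the
    -- deviation to 1 gains a product of two positive factors. No case distinction on `p i` is made.
    increasing⇒≃1 : ∀ i j d → gain u p i j 1ℝ ≐ (1ℝ - p i) * d → 0ℝ < d → p i ≃ 1ℝ
    increasing⇒≃1 i j d gain≐ 0<d = proj₂ (mixed i) , λ pᵢ<1 →
      gain≯0 i j 1ℝ 1∈[0,1] ((1ℝ - p i) * d) gain≐
        (*-pos (1ℝ - p i) d (x<y⇒0<y-x (p i) 1ℝ pᵢ<1) 0<d)

    decreasing⇒≃0 : ∀ i j d → gain u p i j 0ℝ ≐ (p i - 0ℝ) * d → 0ℝ < d → p i ≃ 0ℝ
    -- Here `d` is the negative of the slope, since the deviation moves down by `p i`.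
    decreasing⇒≃0 i j d gain≐ 0<d = (λ 0<pᵢ →
      gain≯0 i j 0ℝ 0∈[0,1] ((p i - 0ℝ) * d) gain≐
        (*-pos (p i - 0ℝ) d (x<y⇒0<y-x 0ℝ (p i) 0<pᵢ) 0<d)) , proj₁ (mixed i)

-- Gains as polynomials.  The definitions repeat those of expectedPayoff over
-- syntactic polynomials, so that their evaluation is definitionally the n-th
-- term of the real number and the ring solver applies to it.

expectationᴾ : ∀ {m n} → Vector (Polynomial m) n → (Vector Move n → Polynomial m) → Polynomial m
expectationᴾ {n = zero}  p f = f []
expectationᴾ {n = suc n} p f =
  head p             :* expectationᴾ (tail p) (λ s → f (follow ∷ s)) :+
  (con 1ℚ :- head p) :* expectationᴾ (tail p) (λ s → f (exit ∷ s))

module _ {m n : ℕ} .{{_ : NonZero n}} where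

  expectedPayoffᴾ : (Outcome n → Polynomial m) → Vector (Polynomial m) n → Fin n → Polynomial m
  expectedPayoffᴾ u p j =
    foldr _:+_ (con 0ℚ) (λ k → probabilityᴾ (a k) :* u (a k)) :+ probabilityᴾ c :* u c
    where
    probabilityᴾ : Outcome n → Polynomial m
    probabilityᴾ o = expectationᴾ p λ s → if does (outcome s j ≟ o) then con 1ℚ else con 0ℚ

0ᴾ 1ᴾ : ∀ {m} → Polynomial m
0ᴾ = con 0ℚ
1ᴾ = con 1ℚ

-- Variables: first the `n` probabilities, then one player's payoff at `c`, then that player's
-- payoffs at the `n` terminals. `environment` lists the values in the same order.
module Symbolic (n : ℕ) where

  pᴾ : Vector (Polynomial (n ℕ.+ suc n)) n
  pᴾ k = var (k ↑ˡ suc n)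

  uᴾ : Outcome n → Polynomial (n ℕ.+ suc n)
  uᴾ c     = var (n ↑ʳ 0F)
  uᴾ (a k) = var (n ↑ʳ suc k)

  environment : Payoff n → Profile n → Fin n → ℕ → Vec ℚ (n ℕ.+ suc n)
  environment u p i t =
    Vec.tabulate (λ k → seq (p k) t) Vec.++ seq (u i c) t Vec.∷ Vec.tabulate (λ k → seq (u i (a k)) t)

  gainᴾ : .{{_ : NonZero n}} → (player initial : Fin n) →
    Polynomial (n ℕ.+ suc n) → Polynomial (n ℕ.+ suc n)
  gainᴾ i j q = expectedPayoffᴾ uᴾ (updateAt pᴾ i (λ _ → q)) j :- expectedPayoffᴾ uᴾ pᴾ j

-- The two-person game

module _ (u : Payoff 2) (p : Profile 2) where

  open Symbolic 2

  -- Each slope that is not a product of positive factors is written as a positive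
  -- number plus multiples of differences that vanish where the slope is used.
  slope₁-from-v₂ slope₂-from-v₁ slope₁-from-v₁ slope₂-from-v₂ : ℝ
  slope₁-from-v₂ = (p 1F - 0ℝ) * (u 0F c - u 0F (a 0F))
  slope₂-from-v₁ = (u 1F (a 1F) - u 1F c) + (p 0F - 1ℝ) * (u 1F (a 1F) - u 1F c)
  slope₁-from-v₁ = (u 0F (a 0F) - u 0F (a 1F)) + (p 1F - 0ℝ) * (u 0F (a 1F) - u 0F c)
  slope₂-from-v₂ = (u 1F (a 0F) - u 1F (a 1F)) + (p 0F - 0ℝ) * (u 1F c - u 1F (a 0F))

  gain₁-from-v₂ : gain u p 0F 1F 1ℝ ≐ (1ℝ - p 0F) * slope₁-from-v₂
  gain₁-from-v₂ t = prove (environment u p 0F t) (gainᴾ 0F 1F 1ᴾ)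
    ((1ᴾ :- pᴾ 0F) :* ((pᴾ 1F :- 0ᴾ) :* (uᴾ c :- uᴾ (a 0F)))) refl

  gain₂-from-v₁ : gain u p 1F 0F 0ℝ ≐ (p 1F - 0ℝ) * slope₂-from-v₁
  gain₂-from-v₁ t = prove (environment u p 1F t) (gainᴾ 1F 0F 0ᴾ)
    ((pᴾ 1F :- 0ᴾ) :* ((uᴾ (a 1F) :- uᴾ c) :+ (pᴾ 0F :- 1ᴾ) :* (uᴾ (a 1F) :- uᴾ c))) refl

  gain₁-from-v₁ : gain u p 0F 0F 0ℝ ≐ (p 0F - 0ℝ) * slope₁-from-v₁
  gain₁-from-v₁ t = prove (environment u p 0F t) (gainᴾ 0F 0F 0ᴾ)
    ((pᴾ 0F :- 0ᴾ) :* ((uᴾ (a 0F) :- uᴾ (a 1F)) :+ (pᴾ 1F :- 0ᴾ) :* (uᴾ (a 1F) :- uᴾ c))) refl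

  gain₂-from-v₂ : gain u p 1F 1F 1ℝ ≐ (1ℝ - p 1F) * slope₂-from-v₂
  gain₂-from-v₂ t = prove (environment u p 1F t) (gainᴾ 1F 1F 1ᴾ)
    ((1ᴾ :- pᴾ 1F) :* ((uᴾ (a 0F) :- uᴾ (a 1F)) :+ (pᴾ 0F :- 0ᴾ) :* (uᴾ c :- uᴾ (a 0F)))) refl

no-UNE₂ : (u : Payoff 2) →
  u 0F c > u 0F (a 0F) → u 0F (a 0F) > u 0F (a 1F) →
  u 1F (a 0F) > u 1F (a 1F) → u 1F (a 1F) > u 1F c →
  ∀ p → ¬ IsUNE u p
-- The contradiction: `p 1F` equals both 0 and 1.
no-UNE₂ u c>₁a₁ a₁>₁a₂ a₁>₂a₂ a₂>₂c p une = proj₂ p₂≃1 (≃0⇒<1 (p 1F) p₂≃0)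
  where
  p₂>0⇒p₁≃1 : 0ℝ < p 1F → p 0F ≃ 1ℝ
  p₂>0⇒p₁≃1 0<p₂ = increasing⇒≃1 une 0F 1F (slope₁-from-v₂ u p) (gain₁-from-v₂ u p)
    (*-pos (p 1F - 0ℝ) (u 0F c - u 0F (a 0F)) (x<y⇒0<y-x 0ℝ (p 1F) 0<p₂) (x<y⇒0<y-x (u 0F (a 0F)) (u 0F c) c>₁a₁))

  p₁≃1⇒p₂≃0 : p 0F ≃ 1ℝ → p 1F ≃ 0ℝ
  p₁≃1⇒p₂≃0 p₁≃1 = decreasing⇒≃0 une 1F 0F (slope₂-from-v₁ u p) (gain₂-from-v₁ u p)
    (0<-perturb (u 1F (a 1F) - u 1F c) (p 0F) 1ℝ (u 1F (a 1F) - u 1F c)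
      (x<y⇒0<y-x (u 1F c) (u 1F (a 1F)) a₂>₂c) p₁≃1)

  p₂≃0 : p 1F ≃ 0ℝ
  p₂≃0 = (λ 0<p₂ → proj₁ (p₁≃1⇒p₂≃0 (p₂>0⇒p₁≃1 0<p₂)) 0<p₂) , proj₁ (IsUNE.mixed une 1F)

  p₁≃0 : p 0F ≃ 0ℝ
  p₁≃0 = decreasing⇒≃0 une 0F 0F (slope₁-from-v₁ u p) (gain₁-from-v₁ u p)
    (0<-perturb (u 0F (a 0F) - u 0F (a 1F)) (p 1F) 0ℝ (u 0F (a 1F) - u 0F c)
      (x<y⇒0<y-x (u 0F (a 1F)) (u 0F (a 0F)) a₁>₁a₂) p₂≃0)

  p₂≃1 : p 1F ≃ 1ℝ
  p₂≃1 = increasing⇒≃1 une 1F 1F (slope₂-from-v₂ u p) (gain₂-from-v₂ u p)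
    (0<-perturb (u 1F (a 0F) - u 1F (a 1F)) (p 0F) 0ℝ (u 1F c - u 1F (a 0F))
      (x<y⇒0<y-x (u 1F (a 1F)) (u 1F (a 0F)) a₁>₂a₂) p₁≃0)

-- The three-person game

module _ (u : Payoff 3) (p : Profile 3) (i : Fin 3) where

  private
    j = next i
    k = next j

  -- From `v i`, `slope-up` is the slope expanded around `p j = 0`, and `slope-down` is its negative
  -- expanded around `p j = 1`, `p k = 0`. From `v j`, the move of player `i` matters only if `j`
  -- and `k` both follow; it then decides between `a i` and `c`.
  slope-up slope-down slope-down-from-next : ℝ
  slope-up = (u i (a j) - u i (a i)) +
    (p j - 0ℝ) * ((1ℝ - p k) * u i (a k) + p k * u i c - u i (a j))
  slope-down = (u i (a i) - u i (a k)) + (p j - 1ℝ) * (u i (a j) - u i (a k)) +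
    (p k - 0ℝ) * (p j * (u i (a k) - u i c))
  slope-down-from-next = (p j - 0ℝ) * ((p k - 0ℝ) * (u i (a i) - u i c))

module _ (i : Fin 3) where

  open Symbolic 3

  private
    j = next i
    k = next j

  slope-upᴾ slope-downᴾ slope-down-from-nextᴾ : Polynomial 7
  slope-upᴾ = (uᴾ (a j) :- uᴾ (a i)) :+
    (pᴾ j :- 0ᴾ) :* ((1ᴾ :- pᴾ k) :* uᴾ (a k) :+ pᴾ k :* uᴾ c :- uᴾ (a j))
  slope-downᴾ = (uᴾ (a i) :- uᴾ (a k)) :+ (pᴾ j :- 1ᴾ) :* (uᴾ (a j) :- uᴾ (a k)) :+
    (pᴾ k :- 0ᴾ) :* (pᴾ j :* (uᴾ (a k) :- uᴾ c))
  slope-down-from-nextᴾ = (pᴾ j :- 0ᴾ) :* ((pᴾ k :- 0ᴾ) :* (uᴾ (a i) :- uᴾ c))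

module _ (u : Payoff 3) (p : Profile 3) where

  open Symbolic 3

  gain-up : ∀ i → gain u p i i 1ℝ ≐ (1ℝ - p i) * slope-up u p i
  -- Splitting on `i` lets `next i` and `updateAt` compute, so both sides become concrete
  -- polynomials.
  gain-up 0F t = prove (environment u p 0F t) (gainᴾ 0F 0F 1ᴾ) ((1ᴾ :- pᴾ 0F) :* slope-upᴾ 0F) refl
  gain-up 1F t = prove (environment u p 1F t) (gainᴾ 1F 1F 1ᴾ) ((1ᴾ :- pᴾ 1F) :* slope-upᴾ 1F) refl
  gain-up 2F t = prove (environment u p 2F t) (gainᴾ 2F 2F 1ᴾ) ((1ᴾ :- pᴾ 2F) :* slope-upᴾ 2F) refl

  gain-down : ∀ i → gain u p i i 0ℝ ≐ (p i - 0ℝ) * slope-down u p i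
  gain-down 0F t = prove (environment u p 0F t) (gainᴾ 0F 0F 0ᴾ) ((pᴾ 0F :- 0ᴾ) :* slope-downᴾ 0F) refl
  gain-down 1F t = prove (environment u p 1F t) (gainᴾ 1F 1F 0ᴾ) ((pᴾ 1F :- 0ᴾ) :* slope-downᴾ 1F) refl
  gain-down 2F t = prove (environment u p 2F t) (gainᴾ 2F 2F 0ᴾ) ((pᴾ 2F :- 0ᴾ) :* slope-downᴾ 2F) refl

  gain₁-down-from-v₂ : gain u p 0F 1F 0ℝ ≐ (p 0F - 0ℝ) * slope-down-from-next u p 0F
  gain₁-down-from-v₂ t = prove (environment u p 0F t) (gainᴾ 0F 1F 0ᴾ)
    ((pᴾ 0F :- 0ᴾ) :* slope-down-from-nextᴾ 0F) refl

-- Phrasing the preferences through `next` exploits the rotational symmetry: each forcing step from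
-- a player's own position is argued once for all three players.
no-UNE₃ : (u : Payoff 3) →
  (∀ i → u i (a (next i)) > u i (a i)) →
  (∀ i → u i (a i) > u i (a (next (next i)))) →
  u 0F (a 2F) > u 0F c →
  ∀ p → ¬ IsUNE u p
no-UNE₃ u aⱼ>aᵢ aᵢ>aₖ a₃>₁c p une =
  -- The goal is absurdity, so `0 < p₂` and `0 < p₃` can be assumed in turn, their negations giving
  -- vanishing probabilities; no vanishing index is ever selected.
  pᵢ≄0 1F (≯0⇒≃0 1F λ 0<p₂ → pᵢ≄0 2F (≯0⇒≃0 2F λ 0<p₃ → pᵢ≄0 0F (p₂,p₃>0⇒p₁≃0 0<p₂ 0<p₃)))
  where
  ≯0⇒≃0 : ∀ i → ¬ (0ℝ < p i) → p i ≃ 0ℝ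
  ≯0⇒≃0 i pᵢ≯0 = pᵢ≯0 , proj₁ (IsUNE.mixed une i)

  p₂,p₃>0⇒p₁≃0 : 0ℝ < p 1F → 0ℝ < p 2F → p 0F ≃ 0ℝ
  p₂,p₃>0⇒p₁≃0 0<p₂ 0<p₃ =
    decreasing⇒≃0 une 0F 1F (slope-down-from-next u p 0F) (gain₁-down-from-v₂ u p)
      (*-pos (p 1F - 0ℝ) ((p 2F - 0ℝ) * (u 0F (a 0F) - u 0F c)) (x<y⇒0<y-x 0ℝ (p 1F) 0<p₂)
        (*-pos (p 2F - 0ℝ) (u 0F (a 0F) - u 0F c) (x<y⇒0<y-x 0ℝ (p 2F) 0<p₃)
          (x<y⇒0<y-x (u 0F c) (u 0F (a 0F)) (<-trans (u 0F c) (u 0F (a 2F)) (u 0F (a 0F)) a₃>₁c (aᵢ>aₖ 0F)))))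

  pⱼ≃0⇒pᵢ≃1 : ∀ i → p (next i) ≃ 0ℝ → p i ≃ 1ℝ
  pⱼ≃0⇒pᵢ≃1 i pⱼ≃0 = increasing⇒≃1 une i i (slope-up u p i) (gain-up u p i)
    (0<-perturb (u i (a j) - u i (a i)) (p j) 0ℝ ((1ℝ - p k) * u i (a k) + p k * u i c - u i (a j))
      (x<y⇒0<y-x (u i (a i)) (u i (a j)) (aⱼ>aᵢ i)) pⱼ≃0)
    where
    j = next i
    k = next j

  pⱼ≃1∧pₖ≃0⇒pᵢ≃0 : ∀ i → p (next i) ≃ 1ℝ → p (next (next i)) ≃ 0ℝ → p i ≃ 0ℝ
  pⱼ≃1∧pₖ≃0⇒pᵢ≃0 i pⱼ≃1 pₖ≃0 = decreasing⇒≃0 une i i (slope-down u p i) (gain-down u p i)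
    -- The outer perturbation discards the term with `p k`, the inner one the term with `p j - 1`.
    (0<-perturb ((u i (a i) - u i (a k)) + (p j - 1ℝ) * (u i (a j) - u i (a k))) (p k) 0ℝ
      (p j * (u i (a k) - u i c))
      (0<-perturb (u i (a i) - u i (a k)) (p j) 1ℝ (u i (a j) - u i (a k))
        (x<y⇒0<y-x (u i (a k)) (u i (a i)) (aᵢ>aₖ i)) pⱼ≃1)
      pₖ≃0)
    where
    j = next i
    k = next j

  next³ : ∀ i → next (next (next i)) ≡ i
  next³ 0F = refl
  next³ 1F = refl
  next³ 2F = refl

  pᵢ≄0 : ∀ i → ¬ (p i ≃ 0ℝ)
  pᵢ≄0 i pᵢ≃0 = proj₂ (pⱼ≃0⇒pᵢ≃1 i pⱼ≃0) (≃0⇒<1 (p i) pᵢ≃0)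
    where
    pₖ≃1 : p (next (next i)) ≃ 1ℝ
    -- The successor of `k` is `i` again, but `next` does not reduce on a variable, hence the
    -- transport along `next³`.
    pₖ≃1 = pⱼ≃0⇒pᵢ≃1 (next (next i)) (subst (λ h → p h ≃ 0ℝ) (sym (next³ i)) pᵢ≃0)
    pⱼ≃0 : p (next i) ≃ 0ℝ
    pⱼ≃0 = pⱼ≃1∧pₖ≃0⇒pᵢ≃0 (next i) pₖ≃1 (subst (λ h → p h ≃ 0ℝ) (sym (next³ i)) pᵢ≃0)

proposition7 : ((u : Payoff 2) →
    u 0F c > u 0F (a 0F) → u 0F (a 0F) > u 0F (a 1F) →
    u 1F (a 0F) > u 1F (a 1F) → u 1F (a 1F) > u 1F c →
    ¬ (∃ λ p → IsUNE u p))
    ×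
    ((u : Payoff 3) →
    u 0F (a 1F) > u 0F (a 0F) → u 0F (a 0F) > u 0F (a 2F) → u 0F (a 2F) > u 0F c →
    u 1F (a 2F) > u 1F (a 1F) → u 1F (a 1F) > u 1F (a 0F) → u 1F (a 0F) > u 1F c →
    u 2F (a 0F) > u 2F (a 2F) → u 2F (a 2F) > u 2F (a 1F) → u 2F (a 1F) > u 2F c →
    ¬ (∃ λ p → IsUNE u p))
proposition7 =
  (λ u c>₁a₁ a₁>₁a₂ a₁>₂a₂ a₂>₂c (p , une) → no-UNE₂ u c>₁a₁ a₁>₁a₂ a₁>₂a₂ a₂>₂c p une) ,
  (λ u a₂>₁a₁ a₁>₁a₃ a₃>₁c a₃>₂a₂ a₂>₂a₁ _ a₁>₃a₃ a₃>₃a₂ _ (p , une) → no-UNE₃ u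
    (λ { 0F → a₂>₁a₁ ; 1F → a₃>₂a₂ ; 2F → a₁>₃a₃ })
    (λ { 0F → a₁>₁a₃ ; 1F → a₂>₂a₁ ; 2F → a₃>₃a₂ })
    a₃>₁c p une)
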